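{- Let $d\ge1$ and $1\le r\le d$ be integers. There exist constants $C>0$ and $n_0$ (depending only on $d$ and $r$) such that for all integers $n\ge n_0$: (i) $\overleftarrow{m}_{mon}(\mathbb{T}_n^d,r)\le \frac{2}{r}\binom{d}{r-1}n^{r-1}+Cn^{r-2}$; (ii) $m(\mathbb{T}_n^d,r)\le \frac{1}{r}\binom{d}{r-1}n^{r-1}+Cn^{r-2}$.
   Context: The $d$-dimensional torus $\mathbb{T}_n^d$ is the graph with vertex set $[n]^d=\{1,\dots,n\}^d$, where two vertices are adjacent iff they differ in exactly one coordinate $j$ and in that coordinate $x_j-x'_j\equiv\pm1\pmod n$. A configuration assigns each vertex a state active (1) or inactive (0); its size is the number of active vertices. In $r$-bootstrap percolation ($r$-BP), in each round an inactive vertex with at least $r$ active neighbors becomes active and active vertices stay active forever. In reversible $r$-BP, in each round every vertex becomes active if it has at least $r$ active neighbors and inactive otherwise. A dynamo is an initial configuration $\omega^{(0)}$ such that from some time on all vertices are active forever; it is monotone if moreover no active vertex ever becomes inactive ($\omega^{(t+1)}\ge\omega^{(t)}$ for all $t$). $m(G,r)$ is the minimum size of a dynamo under $r$-BP on $G$; $\overleftarrow{m}_{mon}(G,r)$ is the minimum size of a monotone dynamo under reversible $r$-BP on $G$. -}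

module Defs where

open import Data.Nat using (ℕ; zero; suc; _+_; _*_; _∸_; _^_; _≤_; _≤ᵇ_; _≡ᵇ_)
open import Data.Bool using (Bool; true; false; _∧_; _∨_; not; if_then_else_)
open import Data.Fin using (Fin; toℕ)
open import Data.Vec using (Vec; []; _∷_; zipWith; foldr)
open import Data.List using (List; []; _∷_; map; concatMap; allFin)
open import Data.Nat.ListAction using (sum)
open import Data.Product using (Σ; _×_; _,_)
open import Relation.Binary.PropositionalEquality using (_≡_)

-- Vertices of the torus T_n^d: vectors in {0,…,n-1}^d (coordinates shifted by one
-- relative to the paper's [n] = {1,…,n}; this is an isomorphic relabelling).
Vertex : ℕ → ℕ → Set
Vertex n d = Vec (Fin n) d

allVertices : (n d : ℕ) → List (Vertex n d)
allVertices n zero = [] ∷ []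
allVertices n (suc d) = concatMap (λ i → map (i ∷_) (allVertices n d)) (allFin n)

succMod : {n : ℕ} → Fin n → Fin n → Bool
succMod {n} a b = (toℕ b ≡ᵇ suc (toℕ a)) ∨ ((suc (toℕ a) ≡ᵇ n) ∧ (toℕ b ≡ᵇ 0))

eqFin : {n : ℕ} → Fin n → Fin n → Bool
eqFin a b = toℕ a ≡ᵇ toℕ b

pm1 : {n : ℕ} → Fin n → Fin n → Bool
pm1 a b = succMod a b ∨ succMod b a

diffCount : {n d : ℕ} → Vertex n d → Vertex n d → ℕ
diffCount x y = foldr (λ _ → ℕ) _+_ 0 (zipWith (λ a b → if eqFin a b then 0 else 1) x y)

allClose : {n d : ℕ} → Vertex n d → Vertex n d → Bool
allClose x y = foldr (λ _ → Bool) _∧_ true (zipWith (λ a b → eqFin a b ∨ pm1 a b) x y)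

adjacent : {n d : ℕ} → Vertex n d → Vertex n d → Bool
adjacent x y = (diffCount x y ≡ᵇ 1) ∧ allClose x y

-- configurations: true = active, false = inactive
Config : ℕ → ℕ → Set
Config n d = Vertex n d → Bool

b2n : Bool → ℕ
b2n true = 1
b2n false = 0

size : {n d : ℕ} → Config n d → ℕ
size {n} {d} ω = sum (map (λ x → b2n (ω x)) (allVertices n d))

activeNbrs : {n d : ℕ} → Config n d → Vertex n d → ℕ
activeNbrs {n} {d} ω x = sum (map (λ y → b2n (adjacent x y ∧ ω y)) (allVertices n d))

bpStep : {n d : ℕ} → ℕ → Config n d → Config n d
bpStep r ω x = ω x ∨ (r ≤ᵇ activeNbrs ω x)

revStep : {n d : ℕ} → ℕ → Config n d → Config n d
revStep r ω x = r ≤ᵇ activeNbrs ω x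

iterate : {A : Set} → (A → A) → ℕ → A → A
iterate f zero a = a
iterate f (suc t) a = f (iterate f t a)

IsDynamo : {n d : ℕ} → (Config n d → Config n d) → Config n d → Set
IsDynamo step ω = Σ ℕ λ T → ∀ t → T ≤ t → ∀ x → iterate step t ω x ≡ true

IsMonotone : {n d : ℕ} → (Config n d → Config n d) → Config n d → Set
IsMonotone step ω = ∀ t x → iterate step t ω x ≡ true → iterate step (suc t) ω x ≡ true

IsMonotoneDynamo : {n d : ℕ} → (Config n d → Config n d) → Config n d → Set
IsMonotoneDynamo step ω = IsDynamo step ω × IsMonotone step ω

{-# OPTIONS --safe #-}
module Submission where

-- Write k = r − 1.  Every vertex with fewer than k coordinates ≥ 2 is active; there are O(n^(k−1)) of
-- them.  On each of the C(d,k) coordinate subtori of dimension k, activate moreover the points with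
-- Σ wⱼ xⱼ mod r < σ, where wⱼ = σ j if σ j < r and wⱼ = 0 otherwise; this is a fraction σ/r of the subtorus.
-- Vertices become active in order of their coordinate sum: a vertex with at least r nonzero coordinates
-- has r smaller neighbours, and an inactive point of a subtorus has k smaller neighbours and one active
-- larger one, since stepping up by some σ j carries its residue past r into [0, σ).
-- For σ = 2 every active vertex has r active neighbours: a vertex with fewer than k coordinates ≥ 2 has
-- one in each of the d directions (the threshold 2 instead of 1 is there for this), while inside a subtorus
-- the weights 0 give two each and the weight k ≡ −1, present when k is even, exchanges the residues 0 and 1.
-- The reversible process is then increasing, so the same activation order applies to it.
-- For r = 1 the seed is a single vertex, and two adjacent vertices in the reversible case.

open import Defs
open import Data.Bool using (Bool; true; false; T; _∧_; _∨_; if_then_else_)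
open import Data.Bool.Properties using (T-≡; T-∧; T-∨)
open import Data.Fin using (Fin; zero; suc; toℕ; inject₁; fromℕ<)
open import Data.Fin.Properties using (toℕ-inject₁; toℕ-fromℕ<; toℕ<n; toℕ-injective) renaming (_≟_ to _≟ᶠ_)
open import Data.List using (List; []; _∷_; _++_; map; concatMap; allFin)
open import Data.List.Properties using (map-tabulate; map-++; map-∘; map-cong; map-cong-local)
open import Data.List.Relation.Unary.All as All using (All; []; _∷_)
open import Data.List.Relation.Unary.AllPairs using ([]; _∷_)
open import Data.List.Relation.Unary.Unique.Propositional using (Unique)
open import Data.Nat using (ℕ; zero; suc; _+_; _*_; _∸_; _^_; _≤_; _<_; z≤n; s≤s; _≤ᵇ_; _<ᵇ_; _≡ᵇ_; _<?_; _≤?_; _≟_; NonZero; >-nonZero)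
open import Data.Nat.Combinatorics using (_C_; nCk≡nC[n∸k]; nCn≡1; nCk+nC[k+1]≡[n+1]C[k+1])
open import Data.Nat.DivMod
open import Data.Nat.ListAction using (sum)
open import Data.Nat.ListAction.Properties using (sum-++)
open import Data.Nat.Properties hiding (_≟_; _≤?_; _<?_)
open import Data.Nat.Tactic.RingSolver using (solve-∀)
open import Data.Product using (Σ; _×_; _,_; proj₁; ∃)
open import Data.Sum using (_⊎_; inj₁; inj₂; [_,_]′)
open import Data.Unit using (tt)
open import Data.Vec using ([]; _∷_)
open import Function using (_∘_; id)
open import Function.Bundles using (Equivalence)
open import Relation.Binary.Definitions using (tri<; tri≈; tri>)
open import Relation.Binary.PropositionalEquality
open import Relation.Nullary using (¬_; yes; no; does; contradiction)
open import Relation.Nullary.Decidable using (dec-false)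
open import Algebra.Properties.CommutativeSemigroup +-commutativeSemigroup using (x∙yz≈y∙xz; xy∙z≈xz∙y)

-- Finite sums over lists and over `Fin n`.

sum-map-mono : ∀ {A : Set} {f g : A → ℕ} → (∀ x → f x ≤ g x) →
  ∀ xs → sum (map f xs) ≤ sum (map g xs)
sum-map-mono f≤g []       = z≤n
sum-map-mono f≤g (x ∷ xs) = +-mono-≤ (f≤g x) (sum-map-mono f≤g xs)

sum-map-+ : ∀ {A : Set} (f g : A → ℕ) xs →
  sum (map (λ x → f x + g x) xs) ≡ sum (map f xs) + sum (map g xs)
sum-map-+ f g []       = refl
sum-map-+ f g (x ∷ xs) = begin
  f x + g x + sum (map (λ x → f x + g x) xs)         ≡⟨ cong (f x + g x +_) (sum-map-+ f g xs) ⟩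
  f x + g x + (sum (map f xs) + sum (map g xs))      ≡⟨ +-assoc (f x) (g x) _ ⟩
  f x + (g x + (sum (map f xs) + sum (map g xs)))    ≡⟨ cong (f x +_) (x∙yz≈y∙xz (g x) (sum (map f xs)) _) ⟩
  f x + (sum (map f xs) + (g x + sum (map g xs)))    ≡⟨ +-assoc (f x) _ _ ⟨
  f x + sum (map f xs) + (g x + sum (map g xs))      ∎
  where
  open ≡-Reasoning

sum-map-concatMap : ∀ {A B : Set} (g : B → ℕ) (f : A → List B) xs →
  sum (map g (concatMap f xs)) ≡ sum (map (λ x → sum (map g (f x))) xs)
sum-map-concatMap g f []       = refl
sum-map-concatMap g f (x ∷ xs) = begin
  sum (map g (f x ++ concatMap f xs))                ≡⟨ cong sum (map-++ g (f x) _) ⟩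
  sum (map g (f x) ++ map g (concatMap f xs))        ≡⟨ sum-++ (map g (f x)) _ ⟩
  sum (map g (f x)) + sum (map g (concatMap f xs))   ≡⟨ cong (sum (map g (f x)) +_) (sum-map-concatMap g f xs) ⟩
  sum (map g (f x)) + _                              ∎
  where open ≡-Reasoning

∑ : ∀ {n} → (Fin n → ℕ) → ℕ
∑ {n} f = sum (map f (allFin n))

∑-mono : ∀ {n} {f g : Fin n → ℕ} → (∀ i → f i ≤ g i) → ∑ f ≤ ∑ g
∑-mono f≤g = sum-map-mono f≤g (allFin _)

∑-suc : ∀ {n} (f : Fin (suc n) → ℕ) → ∑ f ≡ f zero + ∑ (f ∘ suc)
∑-suc f = cong (λ l → f zero + sum l) (trans (map-tabulate suc f) (sym (map-tabulate id (f ∘ suc))))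

∑-≤ : ∀ {n} {f : Fin n → ℕ} {b} → (∀ i → f i ≤ b) → ∑ f ≤ n * b
∑-≤ {zero}  f≤b = z≤n
∑-≤ {suc n} {f} f≤b = ≤-trans (≤-reflexive (∑-suc f)) (+-mono-≤ (f≤b zero) (∑-≤ (f≤b ∘ suc)))

without : ∀ {n} → Fin n → (Fin n → ℕ) → Fin n → ℕ
without i f j = if does (i ≟ᶠ j) then 0 else f j

∑-without : ∀ {n} (i : Fin n) f → f i + ∑ (without i f) ≤ ∑ f
∑-without zero    f rewrite ∑-suc f | ∑-suc (without zero f) = ≤-refl
∑-without (suc i) f rewrite ∑-suc f | ∑-suc (without (suc i) f) = begin
  f (suc i) + (f zero + ∑ (without i (f ∘ suc)))  ≡⟨ x∙yz≈y∙xz (f (suc i)) (f zero) _ ⟩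
  f zero + (f (suc i) + ∑ (without i (f ∘ suc)))  ≤⟨ +-monoʳ-≤ (f zero) (∑-without i (f ∘ suc)) ⟩
  f zero + ∑ (f ∘ suc)                            ∎
  where
  open ≤-Reasoning

-- Each listed index is zeroed by `without` once it has been counted; uniqueness ensures that the
-- rest of the list does not see the deletion.
sum≤∑ : ∀ {n} (f : Fin n → ℕ) {is} → Unique is → sum (map f is) ≤ ∑ f
sum≤∑ f []                         = z≤n
sum≤∑ f {i ∷ is} (i∉is ∷ unique) = begin
  f i + sum (map f is)              ≡⟨ cong (λ l → f i + sum l) (map-cong-local (All.map unchanged i∉is)) ⟩
  f i + sum (map (without i f) is)  ≤⟨ +-monoʳ-≤ (f i) (sum≤∑ (without i f) unique) ⟩
  f i + ∑ (without i f)             ≤⟨ ∑-without i f ⟩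
  ∑ f                               ∎
  where
  open ≤-Reasoning
  unchanged : ∀ {j} → i ≢ j → f j ≡ without i f j
  unchanged {j} i≢j rewrite dec-false (i ≟ᶠ j) i≢j = refl

term≤∑ : ∀ {n} (f : Fin n → ℕ) i → f i ≤ ∑ f
term≤∑ f i = ≤-trans (≤-reflexive (sym (+-identityʳ (f i)))) (sum≤∑ f ([] ∷ []))

-- Sums over all vertices, split by the first coordinate.

vertexSum : ∀ {n d} → (Vertex n d → ℕ) → ℕ
vertexSum {n} {d} g = sum (map g (allVertices n d))

vertexSum-suc : ∀ {n d} (g : Vertex n (suc d) → ℕ) →
  vertexSum g ≡ ∑ λ a → vertexSum λ xs → g (a ∷ xs)
vertexSum-suc {n} {d} g = trans
  (sum-map-concatMap g (λ i → map (i ∷_) (allVertices n d)) (allFin n))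
  (cong sum (map-cong (λ i → cong sum (sym (map-∘ (allVertices n d)))) (allFin n)))

vertexSum-mono : ∀ {n d} {f g : Vertex n d → ℕ} → (∀ x → f x ≤ g x) → vertexSum f ≤ vertexSum g
vertexSum-mono f≤g = sum-map-mono f≤g (allVertices _ _)

term≤vertexSum : ∀ {n d} (g : Vertex n d → ℕ) x → g x ≤ vertexSum g
term≤vertexSum g []       = m≤m+n _ 0
term≤vertexSum g (a ∷ xs) = begin
  g (a ∷ xs)                               ≤⟨ term≤vertexSum (g ∘ (a ∷_)) xs ⟩
  vertexSum (g ∘ (a ∷_))                   ≤⟨ term≤∑ (λ a → vertexSum (g ∘ (a ∷_))) a ⟩
  (∑ λ a → vertexSum λ xs → g (a ∷ xs))    ≡⟨ vertexSum-suc g ⟨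
  vertexSum g                              ∎
  where open ≤-Reasoning

-- The pointwise order on configurations.

infix 4 _⊑_
_⊑_ : ∀ {n d} → Config n d → Config n d → Set
ω ⊑ ω′ = ∀ x → T (ω x) → T (ω′ x)

T⇒1≤ : ∀ {b} → T b → 1 ≤ b2n b
T⇒1≤ {true} _ = ≤-refl

b2n≤1 : ∀ b → b2n b ≤ 1
b2n≤1 true  = ≤-refl
b2n≤1 false = z≤n

b2n-mono : ∀ {b c} → (T b → T c) → b2n b ≤ b2n c
b2n-mono {true}  h = T⇒1≤ (h tt)
b2n-mono {false} h = z≤n

size-mono : ∀ {n d} {ω ω′ : Config n d} → ω ⊑ ω′ → size ω ≤ size ω′
size-mono ω⊑ω′ = vertexSum-mono λ x → b2n-mono (ω⊑ω′ x)

∧-monoʳ : ∀ b {c c′} → (T c → T c′) → T (b ∧ c) → T (b ∧ c′)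
∧-monoʳ true h = h

activeNbrs-mono : ∀ {n d} {ω ω′ : Config n d} → ω ⊑ ω′ → ∀ x → activeNbrs ω x ≤ activeNbrs ω′ x
activeNbrs-mono ω⊑ω′ x = vertexSum-mono λ y → b2n-mono (∧-monoʳ (adjacent x y) (ω⊑ω′ y))

-- Adjacency in the torus and a selection of neighbours.

eqFin-refl : ∀ {n} (a : Fin n) → eqFin a a ≡ true
eqFin-refl a = Equivalence.to T-≡ (≡⇒≡ᵇ (toℕ a) (toℕ a) refl)

diffCount-refl : ∀ {n d} (x : Vertex n d) → diffCount x x ≡ 0
diffCount-refl []       = refl
diffCount-refl (a ∷ xs) rewrite eqFin-refl a = diffCount-refl xs

allClose-refl : ∀ {n d} (x : Vertex n d) → allClose x x ≡ true
allClose-refl []       = refl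
allClose-refl (a ∷ xs) rewrite eqFin-refl a = allClose-refl xs

adjacent-∷ : ∀ {n d} (a : Fin n) (x y : Vertex n d) → adjacent (a ∷ x) (a ∷ y) ≡ adjacent x y
adjacent-∷ a x y rewrite eqFin-refl a = refl

adjacent-head : ∀ {n d} {a b : Fin n} (x : Vertex n d) → a ≢ b → T (pm1 a b) → adjacent (a ∷ x) (b ∷ x) ≡ true
adjacent-head {a = a} {b} x a≢b close with eqFin a b in eq
... | true  = contradiction (toℕ-injective (≡ᵇ⇒≡ _ _ (Equivalence.from T-≡ eq))) a≢b
... | false rewrite diffCount-refl x | allClose-refl x | Equivalence.to T-≡ close = refl

module _ {m : ℕ} where

  private n = 3 + m

  up : Fin n → Fin n
  up i with suc (toℕ i) <? n
  ... | yes i+1<n = fromℕ< i+1<n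
  ... | no  _     = zero

  up-spec : ∀ i → toℕ (up i) ≡ suc (toℕ i) ⊎ (suc (toℕ i) ≡ n × up i ≡ zero)
  up-spec i with suc (toℕ i) <? n
  ... | yes i+1<n = inj₁ (toℕ-fromℕ< i+1<n)
  ... | no  i+1≮n = inj₂ (≤-antisym (toℕ<n i) (≮⇒≥ i+1≮n) , refl)

  up-close : ∀ i → T (pm1 i (up i))
  up-close i = Equivalence.from T-∨ (inj₁ (succ (up-spec i)))
    where
    succ : toℕ (up i) ≡ suc (toℕ i) ⊎ (suc (toℕ i) ≡ n × up i ≡ zero) → T (succMod i (up i))
    succ (inj₁ eq)         = Equivalence.from T-∨ (inj₁ (≡⇒≡ᵇ _ _ eq))
    succ (inj₂ (eq , wrap)) = Equivalence.from T-∨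
      (inj₂ (Equivalence.from T-∧ (≡⇒≡ᵇ _ _ eq , ≡⇒≡ᵇ _ _ (cong toℕ wrap))))

  up-≢ : ∀ i → i ≢ up i
  up-≢ i i≡up with up-spec i
  ... | inj₁ eq         = 1+n≢n (trans (sym eq) (cong toℕ (sym i≡up)))
  ... | inj₂ (eq , wrap) with () ← trans (sym eq) (cong (suc ∘ toℕ) (trans i≡up wrap))

  inject₁-≢ : ∀ (i : Fin (2 + m)) → suc i ≢ inject₁ i
  inject₁-≢ i eq = 1+n≢n (trans (cong toℕ eq) (toℕ-inject₁ i))

  inject₁-close : ∀ (i : Fin (2 + m)) → T (pm1 (suc i) (inject₁ i))
  inject₁-close i = Equivalence.from (T-∨ {x = succMod (suc i) (inject₁ i)})
    (inj₂ (Equivalence.from T-∨ (inj₁ (≡⇒≡ᵇ _ _ (cong suc (sym (toℕ-inject₁ i)))))))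

  -- When `up (suc i)` wraps to 0, `i` has value 1 + m, which is nonzero. This uses side length at
  -- least 3: for n = 2 the two neighbours along a coordinate coincide.
  inject₁≢up : ∀ (i : Fin (2 + m)) → inject₁ i ≢ up (suc i)
  inject₁≢up i eq with up-spec (suc i)
  ... | inj₁ upper       = m≢1+n+m (toℕ i) {1} (trans (sym (toℕ-inject₁ i)) (trans (cong toℕ eq) upper))
  ... | inj₂ (top , wrap) with () ← trans (sym (suc-injective (suc-injective top)))
                                      (trans (sym (toℕ-inject₁ i)) (cong toℕ (trans eq wrap)))

  -- The predecessor n − 1 of 0 is deliberately left out: no step of the argument needs it.
  sides : Fin n → List (Fin n)
  sides zero    = up zero ∷ []
  sides (suc i) = inject₁ i ∷ up (suc i) ∷ []

  sides-unique : ∀ a → Unique (a ∷ sides a)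
  sides-unique zero    = (up-≢ zero ∷ []) ∷ [] ∷ []
  sides-unique (suc i) = (inject₁-≢ i ∷ up-≢ (suc i) ∷ []) ∷ (inject₁≢up i ∷ []) ∷ [] ∷ []

  sides-close : ∀ a → All (λ b → T (pm1 a b)) (sides a)
  sides-close zero    = up-close zero ∷ []
  sides-close (suc i) = inject₁-close i ∷ up-close (suc i) ∷ []

  -- A version of `activeNbrs` computed coordinate by coordinate, so that active neighbours can be
  -- counted by induction on the dimension.
  sideNbrs : ∀ {d} → Config n d → Vertex n d → ℕ
  sideNbrs ω []       = 0
  sideNbrs ω (a ∷ xs) = sum (map (λ b → b2n (ω (b ∷ xs))) (sides a)) + sideNbrs (ω ∘ (a ∷_)) xs

  -- Split all vertices by their first coordinate. Layer `a` contains the neighbours that change a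
  -- later coordinate, and each layer `b` in `sides a` contains the one that changes the first;
  -- `sides-unique` makes these layers distinct.
  sideNbrs≤activeNbrs : ∀ {d} (ω : Config n d) x → sideNbrs ω x ≤ activeNbrs ω x
  sideNbrs≤activeNbrs ω []       = z≤n
  sideNbrs≤activeNbrs ω (a ∷ xs) = begin
    sum (map (λ b → b2n (ω (b ∷ xs))) (sides a)) + sideNbrs (ω ∘ (a ∷_)) xs
      ≤⟨ +-mono-≤ (onList (sides-close a) (headUnique (sides-unique a))) (sideNbrs≤activeNbrs (ω ∘ (a ∷_)) xs) ⟩
    sum (map layer (sides a)) + activeNbrs (ω ∘ (a ∷_)) xs
      ≡⟨ +-comm (sum (map layer (sides a))) _ ⟩
    activeNbrs (ω ∘ (a ∷_)) xs + sum (map layer (sides a))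
      ≤⟨ +-monoˡ-≤ _ own-layer ⟩
    layer a + sum (map layer (sides a))
      ≤⟨ sum≤∑ layer (sides-unique a) ⟩
    ∑ layer
      ≡⟨ vertexSum-suc (λ y → b2n (adjacent (a ∷ xs) y ∧ ω y)) ⟨
    activeNbrs ω (a ∷ xs) ∎
    where
    open ≤-Reasoning
    layer : Fin n → ℕ
    layer b = vertexSum λ ys → b2n (adjacent (a ∷ xs) (b ∷ ys) ∧ ω (b ∷ ys))

    headUnique : ∀ {as} → Unique (a ∷ as) → All (a ≢_) as
    headUnique (a∉as ∷ _) = a∉as

    own-layer : activeNbrs (ω ∘ (a ∷_)) xs ≤ layer a
    own-layer = vertexSum-mono λ ys →
      ≤-reflexive (cong (λ b → b2n (b ∧ ω (a ∷ ys))) (sym (adjacent-∷ a xs ys)))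

    onList : ∀ {bs} → All (λ b → T (pm1 a b)) bs → All (a ≢_) bs →
      sum (map (λ b → b2n (ω (b ∷ xs))) bs) ≤ sum (map layer bs)
    onList []                       []                 = z≤n
    onList (_∷_ {b} close closes) (a≢b ∷ a∉bs) = +-mono-≤
      (≤-trans (≤-reflexive (cong (λ c → b2n (c ∧ ω (b ∷ xs))) (sym (adjacent-head xs a≢b close))))
               (term≤vertexSum (λ ys → b2n (adjacent (a ∷ xs) (b ∷ ys) ∧ ω (b ∷ ys))) xs))
      (onList closes a∉bs)

-- Activation in order of the coordinate sum.

coordSum : ∀ {n d} → Vertex n d → ℕ
coordSum []       = 0
coordSum (a ∷ xs) = toℕ a + coordSum xs

coordSum≤ : ∀ {n d} (x : Vertex n d) → coordSum x ≤ d * n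
coordSum≤ []       = z≤n
coordSum≤ (a ∷ xs) = +-mono-≤ (<⇒≤ (toℕ<n a)) (coordSum≤ xs)

infixl 6 _∪↓_
_∪↓_ : ∀ {n d} → Config n d → Vertex n d → Config n d
(ω ∪↓ x) y = ω y ∨ (coordSum y <ᵇ coordSum x)

-- A certificate that mentions no dynamics: vertices can be activated in order of their coordinate
-- sum, each relying only on `ω` and on strictly smaller vertices.
Percolating : ∀ {n d} → ℕ → Config n d → Set
Percolating r ω = ∀ x → T (ω x) ⊎ r ≤ activeNbrs (ω ∪↓ x) x

module _ {n d : ℕ} (r : ℕ) (step : Config n d → Config n d) (ω : Config n d)
  (activates : ∀ ω′ x → r ≤ activeNbrs ω′ x → T (step ω′ x))
  (grows : ∀ t → iterate step t ω ⊑ iterate step (suc t) ω) where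

  initially : ∀ t → ω ⊑ iterate step t ω
  initially zero    x = id
  initially (suc t) x = grows t x ∘ initially t x

  -- Induction on time: the smaller vertices on which `x` relies are active one round earlier, and
  -- `grows` keeps the initial vertices active meanwhile.
  active-by : Percolating r ω → ∀ t x → coordSum x < t → T (iterate step t ω x)
  active-by perc (suc t) x (s≤s le) with perc x
  ... | inj₁ active = initially (suc t) x active
  ... | inj₂ enough = activates _ x (≤-trans enough (activeNbrs-mono below x))
    where
    below : ω ∪↓ x ⊑ iterate step t ω
    below y = [ initially t y
              , (λ lt → active-by perc t y (<-≤-trans (<ᵇ⇒< (coordSum y) _ lt) le))
              ]′ ∘ Equivalence.to T-∨

  percolating⇒dynamo : Percolating r ω → IsDynamo step ω
  percolating⇒dynamo perc = suc (d * n) , λ t T≤t x →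
    Equivalence.to T-≡ (active-by perc t x (≤-trans (s≤s (coordSum≤ x)) T≤t))

bpStep-dynamo : ∀ {n d} r {ω : Config n d} → Percolating r ω → IsDynamo (bpStep r) ω
bpStep-dynamo r {ω} = percolating⇒dynamo r (bpStep r) ω
  (λ ω′ x h → Equivalence.from (T-∨ {x = ω′ x}) (inj₂ (≤⇒≤ᵇ h)))
  (λ t x h → Equivalence.from T-∨ (inj₁ h))

revStep-mono : ∀ {n d} r {ω ω′ : Config n d} → ω ⊑ ω′ → revStep r ω ⊑ revStep r ω′
revStep-mono r ω⊑ω′ x h = ≤⇒≤ᵇ (≤-trans (≤ᵇ⇒≤ r _ h) (activeNbrs-mono ω⊑ω′ x))

-- Stability says that the first step only adds vertices; monotonicity of the rule carries this
-- inclusion to every later step.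
revStep-monotoneDynamo : ∀ {n d} r {ω : Config n d} →
  (∀ x → T (ω x) → r ≤ activeNbrs ω x) → Percolating r ω → IsMonotoneDynamo (revStep r) ω
revStep-monotoneDynamo {n} {d} r {ω} stable perc =
  percolating⇒dynamo r (revStep r) ω (λ ω′ x → ≤⇒≤ᵇ) grows perc ,
  λ t x → Equivalence.to T-≡ ∘ grows t x ∘ Equivalence.from T-≡
  where
  grows : ∀ t → iterate (revStep {n} {d} r) t ω ⊑ iterate (revStep r) (suc t) ω
  grows zero    x = ≤⇒≤ᵇ ∘ stable x
  grows (suc t) = revStep-mono r (grows t)

-- Support, large coordinates and phase of a vertex.

above : ∀ {n d} → ℕ → Vertex n d → ℕ
above t []       = 0
above t (a ∷ xs) = b2n (t <ᵇ toℕ a) + above t xs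

supp bigs : ∀ {n d} → Vertex n d → ℕ
supp = above 0
bigs = above 1

bigs≤supp : ∀ {n d} (x : Vertex n d) → bigs x ≤ supp x
bigs≤supp []                 = z≤n
bigs≤supp (zero ∷ xs)        = bigs≤supp xs
bigs≤supp (suc zero ∷ xs)    = m≤n⇒m≤1+n (bigs≤supp xs)
bigs≤supp (suc (suc a) ∷ xs) = s≤s (bigs≤supp xs)

-- Nonzero coordinates are ranked 1, 2, … from the right.
phase : ∀ {n d} → (ℕ → ℕ) → Vertex n d → ℕ
phase w []       = 0
phase w (a ∷ xs) = w (suc (supp xs)) * toℕ a + phase w xs

-- Counting active neighbours by induction on the dimension.

one≤ : ∀ {b s t} z → T b → s ≤ t → suc s ≤ b2n b + z + t
one≤ z Tb s≤t = +-mono-≤ (≤-trans (T⇒1≤ Tb) (m≤m+n _ z)) s≤t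

two≤ : ∀ {b c s t} → T b → T c → s ≤ t → 2 + s ≤ b2n b + (b2n c + 0) + t
two≤ Tb Tc s≤t = +-mono-≤ (+-mono-≤ (T⇒1≤ Tb) (≤-trans (T⇒1≤ Tc) (m≤m+n _ 0))) s≤t

snd≤ : ∀ {b s t} z → T b → s ≤ t → suc s ≤ z + (b2n b + 0) + t
snd≤ z Tb s≤t = +-mono-≤ (≤-trans (T⇒1≤ Tb) (≤-trans (m≤m+n _ 0) (m≤n+m _ z))) s≤t

module _ {m : ℕ} where

  private n = 3 + m

  -- Lowering a nonzero coordinate by one gives a neighbour of smaller coordinate sum.
  supp≤sideNbrs : ∀ {d} {ω : Config n d} x → (∀ y → coordSum y < coordSum x → T (ω y)) →
    supp x ≤ sideNbrs ω x
  supp≤sideNbrs [] lower = z≤n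
  supp≤sideNbrs (zero ∷ xs) lower = m≤n⇒m≤o+n _
    (supp≤sideNbrs xs λ y → lower (zero ∷ y))
  supp≤sideNbrs (suc i ∷ xs) lower = one≤ _
    (lower (inject₁ i ∷ xs) (s≤s (≤-reflexive (cong (_+ coordSum xs) (toℕ-inject₁ i)))))
    (supp≤sideNbrs xs λ y y< → lower (suc i ∷ y) (+-monoʳ-< (suc (toℕ i)) y<))

  -- Every coordinate has a step that creates no new coordinate above 1: from 0 to 1, and downwards
  -- from any positive value.
  dimension≤sideNbrs : ∀ {d} {ω : Config n d} x → (∀ y → bigs y ≤ bigs x → T (ω y)) →
    d ≤ sideNbrs ω x
  dimension≤sideNbrs [] small = z≤n
  dimension≤sideNbrs (a ∷ xs) small = go a small
    where
    go : ∀ a {ω} → (∀ y → bigs y ≤ bigs (a ∷ xs) → T (ω y)) → _ ≤ sideNbrs ω (a ∷ xs)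
    go a {ω} small with dimension≤sideNbrs xs (λ y y≤ → small (a ∷ y) (+-monoʳ-≤ _ y≤))
    go zero                {ω} small | ih = one≤ 0 (small (up zero ∷ xs) ≤-refl) ih
    go (suc zero)          {ω} small | ih = one≤ _ (small (zero ∷ xs) ≤-refl) ih
    go (suc (suc zero))    {ω} small | ih = one≤ _ (small (suc zero ∷ xs) (n≤1+n _)) ih
    go (suc (suc (suc i))) {ω} small | ih = one≤ _ (small (suc (suc (inject₁ i)) ∷ xs) ≤-refl) ih

  -- Wrapping from n - 1 to 0 loses a coordinate that is at least 2. Otherwise the coordinate stays
  -- nonzero, no rank changes, and the phase grows by the weight of its rank.
  up-phase : ∀ {d} w i (xs : Vertex n d) →
    bigs (up (suc i) ∷ xs) < bigs (suc i ∷ xs) ⊎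
    (supp (up (suc i) ∷ xs) ≡ supp (suc i ∷ xs) ×
     phase w (up (suc i) ∷ xs) ≡ w (suc (supp xs)) + phase w (suc i ∷ xs))
  up-phase w i xs = raise (up (suc i)) (up-spec (suc i))
    where
    raise : ∀ b → toℕ b ≡ 2 + toℕ i ⊎ (2 + toℕ i ≡ n × b ≡ zero) →
      bigs (b ∷ xs) < bigs (suc i ∷ xs) ⊎
      (supp (b ∷ xs) ≡ supp (suc i ∷ xs) ×
       phase w (b ∷ xs) ≡ w (suc (supp xs)) + phase w (suc i ∷ xs))
    raise b (inj₁ next) rewrite next = inj₂ (refl ,
      trans (cong (_+ phase w xs) (*-suc (w (suc (supp xs))) _)) (+-assoc (w (suc (supp xs))) _ _))
    raise b (inj₂ (top , refl)) rewrite suc-injective (suc-injective top) = inj₁ ≤-refl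

  -- The step from 2 to 1 lowers `bigs`; from 3 upwards the phase drops by the weight of the rank.
  down-phase : ∀ {d} w i (xs : Vertex n d) →
    bigs (inject₁ (suc i) ∷ xs) < bigs (suc (suc i) ∷ xs) ⊎
    (supp (inject₁ (suc i) ∷ xs) ≡ supp (suc (suc i) ∷ xs) ×
     w (suc (supp xs)) + phase w (inject₁ (suc i) ∷ xs) ≡ phase w (suc (suc i) ∷ xs))
  down-phase w zero    xs = inj₁ ≤-refl
  down-phase w (suc i) xs = inj₂ (refl , (begin
    w′ + (w′ * suc (suc (toℕ (inject₁ i))) + phase w xs)  ≡⟨ cong (λ t → w′ + (w′ * suc (suc t) + phase w xs)) (toℕ-inject₁ i) ⟩
    w′ + (w′ * suc (suc (toℕ i)) + phase w xs)            ≡⟨ +-assoc w′ _ _ ⟨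
    w′ + w′ * suc (suc (toℕ i)) + phase w xs              ≡⟨ cong (_+ phase w xs) (*-suc w′ _) ⟨
    w′ * suc (suc (suc (toℕ i))) + phase w xs             ∎))
    where
    open ≡-Reasoning
    w′ = w (suc (supp xs))

  -- Equal supports give the head the same rank on both sides, so a phase difference between the
  -- tails survives.
  phase-∷ : ∀ {d} w p (a : Fin n) (y xs : Vertex n d) → supp y ≡ supp xs →
    phase w y ≡ p + phase w xs → phase w (a ∷ y) ≡ p + phase w (a ∷ xs)
  phase-∷ w p a y xs same eq rewrite same | eq =
    x∙yz≈y∙xz (w (suc (supp xs)) * toℕ a) p _


  -- Each nonzero coordinate supplies its lower neighbour; the coordinate of rank `j` supplies its
  -- upper one as well, which is the extra neighbour.
  supp<sideNbrs : ∀ {d} w j {ω : Config n d} x →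
    (∀ y → coordSum y < coordSum x → T (ω y)) →
    (∀ y → bigs y < bigs x ⊎ (supp y ≡ supp x × phase w y ≡ w j + phase w x) → T (ω y)) →
    1 ≤ j → j ≤ supp x → supp x < sideNbrs ω x
  supp<sideNbrs w j [] lower upper 1≤j j≤0 = contradiction (≤-trans 1≤j j≤0) λ()
  supp<sideNbrs w j {ω} (a ∷ xs) lower upper 1≤j j≤ = go a lower upper j≤
    where
    rest : ∀ a {ω} →
      (∀ y → coordSum y < coordSum (a ∷ xs) → T (ω y)) →
      (∀ y → bigs y < bigs (a ∷ xs) ⊎
        (supp y ≡ supp (a ∷ xs) × phase w y ≡ w j + phase w (a ∷ xs)) → T (ω y)) →
      j ≤ supp xs → supp xs < sideNbrs (ω ∘ (a ∷_)) xs
    rest a lower upper j≤ = supp<sideNbrs w j xs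
      (λ y y< → lower (a ∷ y) (+-monoʳ-< (toℕ a) y<))
      (λ { y (inj₁ y<) → upper (a ∷ y) (inj₁ (+-monoʳ-< _ y<))
         ; y (inj₂ (same , eq)) → upper (a ∷ y)
             (inj₂ (cong (_ +_) same , phase-∷ w (w j) a y xs same eq)) })
      1≤j j≤

    go : ∀ a {ω} →
      (∀ y → coordSum y < coordSum (a ∷ xs) → T (ω y)) →
      (∀ y → bigs y < bigs (a ∷ xs) ⊎
        (supp y ≡ supp (a ∷ xs) × phase w y ≡ w j + phase w (a ∷ xs)) → T (ω y)) →
      j ≤ supp (a ∷ xs) → supp (a ∷ xs) < sideNbrs ω (a ∷ xs)
    go zero lower upper j≤ = m≤n⇒m≤o+n _ (rest zero lower upper j≤)
    -- A nonzero head is the leftmost nonzero coordinate, so its rank is `suc (supp xs)`.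
    go (suc i) lower upper j≤ with j ≟ suc (supp xs)
    ... | yes refl = two≤
          (lower (inject₁ i ∷ xs) (s≤s (≤-reflexive (cong (_+ coordSum xs) (toℕ-inject₁ i)))))
          (upper (up (suc i) ∷ xs) (up-phase w i xs))
          (supp≤sideNbrs xs λ y y< → lower (suc i ∷ y) (+-monoʳ-< (suc (toℕ i)) y<))
    ... | no j≢ = one≤ _
          (lower (inject₁ i ∷ xs) (s≤s (≤-reflexive (cong (_+ coordSum xs) (toℕ-inject₁ i)))))
          (rest (suc i) lower upper (≤-pred (≤∧≢⇒< j≤ j≢)))

  -- A coordinate of rank j contributes 2 if 2j > k, one if 2j = k and none otherwise.
  doubled-supp≤sideNbrs : ∀ {d} w k {ω : Config n d} x → 1 ≤ k →
    (∀ j → k < 2 * j → w j ≡ 0) → (∀ j → k ≡ 2 * j → w j ≡ k) →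
    bigs x ≡ supp x →
    (∀ y → bigs y < bigs x → T (ω y)) →
    (∀ y → supp y ≡ supp x → phase w y ≡ phase w x → T (ω y)) →
    (∀ y → supp y ≡ supp x → phase w y ≡ k + phase w x → T (ω y)) ⊎
    (∀ y → supp y ≡ supp x → phase w x ≡ k + phase w y → T (ω y)) →
    2 * supp x + 2 ∸ suc k ≤ sideNbrs ω x
  doubled-supp≤sideNbrs w (suc k) [] 1≤k w0 wk full drop level shift = ≤-reflexive (0∸n≡0 k)
  doubled-supp≤sideNbrs w k (a ∷ xs) 1≤k w0 wk = go a
    where
    Drop Level Up Down : ∀ {d} → Config n d → Vertex n d → Set
    Drop ω x  = ∀ y → bigs y < bigs x → T (ω y)
    Level ω x = ∀ y → supp y ≡ supp x → phase w y ≡ phase w x → T (ω y)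
    Up ω x    = ∀ y → supp y ≡ supp x → phase w y ≡ k + phase w x → T (ω y)
    Down ω x  = ∀ y → supp y ≡ supp x → phase w x ≡ k + phase w y → T (ω y)

    s = suc (supp xs)

    rest : ∀ a {ω} → bigs xs ≡ supp xs → Drop ω (a ∷ xs) → Level ω (a ∷ xs) →
      Up ω (a ∷ xs) ⊎ Down ω (a ∷ xs) → 2 * supp xs + 2 ∸ suc k ≤ sideNbrs (ω ∘ (a ∷_)) xs
    rest a full drop level shift = doubled-supp≤sideNbrs w k xs 1≤k w0 wk full
      (λ y y< → drop (a ∷ y) (+-monoʳ-< _ y<))
      (λ y same eq → level (a ∷ y) (cong (_ +_) same) (phase-∷ w 0 a y xs same eq))
      ([ (λ up′ → inj₁ λ y same eq → up′ (a ∷ y) (cong (_ +_) same) (phase-∷ w k a y xs same eq))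
       , (λ dn′ → inj₂ λ y same eq → dn′ (a ∷ y) (cong (_ +_) same) (phase-∷ w k a xs y (sym same) eq))
       ]′ shift)

    go : ∀ a {ω} → bigs (a ∷ xs) ≡ supp (a ∷ xs) → Drop ω (a ∷ xs) → Level ω (a ∷ xs) →
      Up ω (a ∷ xs) ⊎ Down ω (a ∷ xs) → 2 * supp (a ∷ xs) + 2 ∸ suc k ≤ sideNbrs ω (a ∷ xs)
    go zero full drop level shift = m≤n⇒m≤o+n _ (rest zero full drop level shift)
    -- `full` makes every nonzero coordinate at least 2, so a coordinate 1 cannot occur.
    go (suc zero) full = contradiction (≤-trans (≤-reflexive (sym full)) (bigs≤supp xs)) 1+n≰n
    go a@(suc (suc i)) {ω} full drop level shift with <-cmp k (2 * s)
    -- Weight 0: both neighbours keep the phase, unless `bigs` drops, and are active either way.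
    ... | tri< k<2s _ _ = begin
      2 * s + 2 ∸ suc k                 ≡⟨ cong (λ t → t + 2 ∸ suc k) (*-suc 2 (supp xs)) ⟩
      2 + (2 * supp xs + 2) ∸ suc k     ≤⟨ m≤n+o⇒m∸n≤o _ (suc k) (≤-trans (+-monoʳ-≤ 2 (m≤n+m∸n _ (suc k)))
                                             (≤-reflexive (x∙yz≈y∙xz 2 (suc k) _))) ⟩
      2 + (2 * supp xs + 2 ∸ suc k)     ≤⟨ two≤ down-active up-active (rest a (suc-injective full) drop level shift) ⟩
      sideNbrs ω (a ∷ xs)               ∎
      where
      open ≤-Reasoning
      down-active : T (ω (inject₁ (suc i) ∷ xs))
      down-active with down-phase w i xs
      ... | inj₁ fewer       = drop _ fewer
      ... | inj₂ (same , eq) = level _ same (trans (cong (_+ phase w (inject₁ (suc i) ∷ xs)) (sym (w0 s k<2s))) eq)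
      up-active : T (ω (up a ∷ xs))
      up-active with up-phase w (suc i) xs
      ... | inj₁ fewer       = drop _ fewer
      ... | inj₂ (same , eq) = level _ same (trans eq (cong (_+ phase w (a ∷ xs)) (w0 s k<2s)))
    ... | tri≈ _ k≡2s _ = ≤-trans (≤-reflexive one) (side shift)
      where
      one : 2 * s + 2 ∸ suc k ≡ 1
      one = trans (cong₂ (λ a b → a ∸ suc b) (+-comm (2 * s) 2) k≡2s) (m+n∸n≡m 1 (2 * s))
      side : Up ω (a ∷ xs) ⊎ Down ω (a ∷ xs) → 1 ≤ sideNbrs ω (a ∷ xs)
      side (inj₁ up′) = snd≤ {t = sideNbrs (ω ∘ (a ∷_)) xs} (b2n (ω (inject₁ (suc i) ∷ xs))) up-active z≤n
        where
        up-active : T (ω (up a ∷ xs))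
        up-active with up-phase w (suc i) xs
        ... | inj₁ fewer       = drop _ fewer
        ... | inj₂ (same , eq) = up′ _ same (trans eq (cong (_+ phase w (a ∷ xs)) (wk s k≡2s)))
      side (inj₂ dn′) = one≤ _ down-active z≤n
        where
        down-active : T (ω (inject₁ (suc i) ∷ xs))
        down-active with down-phase w i xs
        ... | inj₁ fewer       = drop _ fewer
        ... | inj₂ (same , eq) = dn′ _ same (trans (sym eq) (cong (_+ phase w (inject₁ (suc i) ∷ xs)) (wk s k≡2s)))
    -- The truncated subtraction makes the bound 0 here, since 2s + 2 is at most k + 1.
    ... | tri> _ _ 2s<k = ≤-trans (≤-reflexive (m≤n⇒m∸n≡0 {2 * s + 2} {suc k} (≤-trans (≤-reflexive (+-comm (2 * s) 2)) (s≤s 2s<k)))) z≤n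

-- Residues, weights and the seed.

%-absorbˡ : ∀ m n r .{{_ : NonZero r}} → (m % r + n) % r ≡ (m + n) % r
%-absorbˡ m n r = begin
  (m % r + n) % r          ≡⟨ %-distribˡ-+ (m % r) n r ⟩
  (m % r % r + n % r) % r  ≡⟨ cong (λ t → (t + n % r) % r) (m%n%n≡m%n m r) ⟩
  (m % r + n % r) % r      ≡⟨ %-distribˡ-+ m n r ⟨
  (m + n) % r              ∎
  where open ≡-Reasoning

-- In the seed, k = r − 1, with σ = 1 for bootstrap percolation and σ = 2 for the reversible rule.
weight : ℕ → ℕ → ℕ → ℕ
weight k σ j = if σ * j ≤ᵇ k then σ * j else 0

weight-small : ∀ k σ j → σ * j ≤ k → weight k σ j ≡ σ * j
weight-small k σ j le rewrite Equivalence.to T-≡ (≤⇒≤ᵇ le) = refl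

weight-large : ∀ k σ j → k < σ * j → weight k σ j ≡ 0
weight-large k σ j gt with σ * j ≤ᵇ k in eq
... | true  = contradiction (≤ᵇ⇒≤ (σ * j) k (Equivalence.from T-≡ eq)) (<⇒≱ gt)
... | false = refl

-- The modulus `suc k` is r. Once `bigs x` reaches `k`, the bound `supp x ≤ k` forces exactly k
-- nonzero coordinates, all at least 2, so `x` lies in a single k-dimensional coordinate subtorus.
seed : ∀ {n d} → ℕ → ℕ → Config n d
seed k σ x = (bigs x <ᵇ k) ∨ ((supp x ≤ᵇ k) ∧ (phase (weight k σ) x % suc k <ᵇ σ))

thin⇒seed : ∀ {n d} k σ (x : Vertex n d) → bigs x < k → T (seed k σ x)
thin⇒seed k σ x lt = Equivalence.from T-∨ (inj₁ (<⇒<ᵇ lt))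

phase⇒seed : ∀ {n d} k σ (x : Vertex n d) → supp x ≤ k →
  phase (weight k σ) x % suc k < σ → T (seed k σ x)
phase⇒seed k σ x le lt = Equivalence.from (T-∨ {x = bigs x <ᵇ k})
  (inj₂ (Equivalence.from T-∧ (≤⇒≤ᵇ le , <⇒<ᵇ lt)))

seed⇒phase : ∀ {n d} k σ (x : Vertex n d) → T (seed k σ x) → ¬ bigs x < k →
  supp x ≤ k × phase (weight k σ) x % suc k < σ
seed⇒phase k σ x active ≮ with Equivalence.to (T-∨ {x = bigs x <ᵇ k}) active
... | inj₁ lt  = contradiction (<ᵇ⇒< _ k lt) ≮
... | inj₂ both with le , lt ← Equivalence.to T-∧ both = ≤ᵇ⇒≤ _ k le , <ᵇ⇒< _ σ lt

-- The rank is 1 + ⌊(k − c) / σ⌋, the first at which c + σ j passes k.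
climb : ∀ k σ c → 1 ≤ σ → σ ≤ c → c ≤ k →
  ∃ λ j → 1 ≤ j × σ * j ≤ k × ∃ λ e → e < σ × c + σ * j ≡ e + suc k
climb k σ@(suc _) c 1≤σ σ≤c c≤k = suc q , s≤s z≤n , σj≤k , e , e<σ , total
  where
  q = (k ∸ c) / σ
  rem = (k ∸ c) % σ
  -- The overshoot: c + σ (q + 1) = k - rem + σ = (k + 1) + (σ - 1 - rem).
  e = σ ∸ suc rem
  e<σ : e < σ
  e<σ = s≤s (m∸n≤m _ rem)
  k≡ : k ≡ c + (rem + q * σ)
  k≡ = trans (sym (m+[n∸m]≡n c≤k)) (cong (c +_) (m≡m%n+[m/n]*n (k ∸ c) σ))
  σ≡ : σ ≡ e + suc rem
  σ≡ = sym (m∸n+n≡m (m%n<n (k ∸ c) σ))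
  total : c + σ * suc q ≡ e + suc k
  total = begin
    c + σ * suc q                      ≡⟨ cong (c +_) (*-suc σ q) ⟩
    c + (σ + σ * q)                    ≡⟨ cong (λ t → c + (t + σ * q)) σ≡ ⟩
    c + (e + suc rem + σ * q)          ≡⟨ arrange c e rem σ q ⟩
    e + suc (c + (rem + q * σ))        ≡⟨ cong (λ t → e + suc t) k≡ ⟨
    e + suc k                          ∎
    where
    open ≡-Reasoning
    arrange : ∀ c e r s q → c + (e + suc r + s * q) ≡ e + suc (c + (r + q * s))
    arrange = solve-∀
  -- Here `σ ≤ c`, that is, an inactive starting residue, keeps the rank among those of nonzero
  -- weight.
  σj≤k : σ * suc q ≤ k
  σj≤k = begin
    σ * suc q             ≡⟨ *-suc σ q ⟩
    σ + σ * q             ≤⟨ +-mono-≤ σ≤c (≤-reflexive (*-comm σ q)) ⟩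
    c + q * σ             ≤⟨ +-monoʳ-≤ c (m≤n+m _ rem) ⟩
    c + (rem + q * σ)     ≡⟨ k≡ ⟨
    k                     ∎
    where open ≤-Reasoning

-- The seed percolates, and for σ = 2 it is stable.

module _ {m : ℕ} where

  private n = 3 + m

  seed-percolating : ∀ {d} k σ → 1 ≤ σ → Percolating {n} {d} (suc k) (seed k σ)
  seed-percolating {d} k σ 1≤σ x with supp x ≤? k
  ... | no supp≰k = inj₂ (≤-trans (≰⇒> supp≰k) (≤-trans
          (supp≤sideNbrs x λ y y< → Equivalence.from (T-∨ {x = seed k σ y}) (inj₂ (<⇒<ᵇ y<)))
          (sideNbrs≤activeNbrs _ x)))
  ... | yes supp≤k with bigs x <? k
  ... | yes bigs<k = inj₁ (thin⇒seed k σ x bigs<k)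
  ... | no bigs≮k with phase (weight k σ) x % suc k <? σ
  ... | yes lt = inj₁ (phase⇒seed k σ x supp≤k lt)
  -- The residue lies in [σ, k]; `climb` chooses the coordinate whose upward step lands in [0, σ)
  -- modulo k + 1.
  ... | no ≮ with climb k σ (phase (weight k σ) x % suc k) 1≤σ (≮⇒≥ ≮) (≤-pred (m%n<n (phase (weight k σ) x) (suc k)))
  ... | j , 1≤j , σj≤k , e , e<σ , eq = inj₂ (≤-trans
          (subst (λ s → suc s ≤ sideNbrs (seed k σ ∪↓ x) x) supp≡k
            (supp<sideNbrs w j x
              (λ y y< → Equivalence.from (T-∨ {x = seed k σ y}) (inj₂ (<⇒<ᵇ y<)))
              (λ y h → Equivalence.from T-∨ (inj₁ (upper y h)))
              1≤j (subst (j ≤_) (sym supp≡k) j≤k)))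
          (sideNbrs≤activeNbrs _ x))
    where
    w = weight k σ
    supp≡k : supp x ≡ k
    supp≡k = ≤-antisym supp≤k (≤-trans (≮⇒≥ bigs≮k) (bigs≤supp x))
    -- The ranks that occur in `x` are 1 to `supp x`, which equals `k`, so rank `j` belongs to an
    -- actual coordinate.
    j≤k : j ≤ k
    j≤k = ≤-trans (m≤n*m j σ {{>-nonZero 1≤σ}}) σj≤k
    upper : ∀ y → bigs y < bigs x ⊎ (supp y ≡ supp x × phase w y ≡ w j + phase w x) → T (seed k σ y)
    upper y (inj₁ fewer) = thin⇒seed k σ y (<-≤-trans fewer (≤-trans (bigs≤supp x) supp≤k))
    upper y (inj₂ (same , raised)) = phase⇒seed k σ y (≤-trans (≤-reflexive same) supp≤k) (begin-strict
      phase w y % suc k                       ≡⟨ cong (_% suc k) raised ⟩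
      (w j + phase w x) % suc k               ≡⟨ cong (λ t → (t + phase w x) % suc k) (weight-small k σ j σj≤k) ⟩
      (σ * j + phase w x) % suc k             ≡⟨ cong (_% suc k) (+-comm (σ * j) _) ⟩
      (phase w x + σ * j) % suc k             ≡⟨ %-absorbˡ (phase w x) (σ * j) (suc k) ⟨
      (phase w x % suc k + σ * j) % suc k     ≡⟨ cong (_% suc k) eq ⟩
      (e + suc k) % suc k                     ≡⟨ [m+n]%n≡m%n e (suc k) ⟩
      e % suc k                               ≤⟨ m%n≤m e (suc k) ⟩
      e                                       <⟨ e<σ ⟩
      σ                                       ∎)
      where open ≤-Reasoning

  seed-stable : ∀ {d} k → 1 ≤ k → suc k ≤ d → (x : Vertex n d) → T (seed k 2 x) →
    suc k ≤ activeNbrs (seed k 2) x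
  seed-stable {d} k 1≤k k<d x active with bigs x <? k
  ... | yes bigs<k = ≤-trans k<d (≤-trans
          (dimension≤sideNbrs x λ y y≤ → thin⇒seed k 2 y (≤-<-trans y≤ bigs<k))
          (sideNbrs≤activeNbrs _ x))
  ... | no bigs≮k with seed⇒phase k 2 x active bigs≮k
  ... | supp≤k , p<2 = ≤-trans (≤-reflexive count) (≤-trans
          (doubled-supp≤sideNbrs w k x 1≤k (λ j → weight-large k 2 j)
            (λ j k≡2j → trans (weight-small k 2 j (≤-reflexive (sym k≡2j))) (sym k≡2j))
            (trans bigs≡k (sym supp≡k))
            (λ y fewer → thin⇒seed k 2 y (<-≤-trans fewer (≤-reflexive bigs≡k)))
            (λ y same eq → on-level y same (subst (λ p → p % suc k < 2) (sym eq) p<2))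
            (shift (phase w x % suc k) refl p<2))
          (sideNbrs≤activeNbrs _ x))
    where
    w = weight k 2
    bigs≡k : bigs x ≡ k
    bigs≡k = ≤-antisym (≤-trans (bigs≤supp x) supp≤k) (≮⇒≥ bigs≮k)
    supp≡k : supp x ≡ k
    supp≡k = ≤-antisym supp≤k (≤-trans (≮⇒≥ bigs≮k) (bigs≤supp x))
    count : suc k ≡ 2 * supp x + 2 ∸ suc k
    count rewrite supp≡k = sym (trans (cong (_∸ suc k) (double k)) (m+n∸n≡m (suc k) (suc k)))
      where
      double : ∀ k → 2 * k + 2 ≡ suc k + suc k
      double = solve-∀
    on-level : (y : Vertex n d) → supp y ≡ supp x → phase w y % suc k < 2 → T (seed k 2 y)
    on-level y same = phase⇒seed k 2 y (≤-trans (≤-reflexive same) supp≤k)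
    -- Modulo k + 1, subtracting k adds 1 and adding k subtracts 1: residue 0 pairs with a smaller
    -- phase of residue 1, and residue 1 with a larger phase of residue 0.
    shift : ∀ p → phase w x % suc k ≡ p → p < 2 →
      ((y : Vertex n d) → supp y ≡ supp x → phase w y ≡ k + phase w x → T (seed k 2 y)) ⊎
      ((y : Vertex n d) → supp y ≡ supp x → phase w x ≡ k + phase w y → T (seed k 2 y))
    shift zero p≡0 _ = inj₂ λ y same eq → on-level y same (s≤s (begin
      phase w y % suc k                       ≡⟨ [m+n]%n≡m%n (phase w y) (suc k) ⟨
      (phase w y + suc k) % suc k             ≡⟨ cong (_% suc k) (trans (+-comm _ (suc k)) (+-comm 1 (k + phase w y))) ⟩
      (k + phase w y + 1) % suc k             ≡⟨ cong (λ t → (t + 1) % suc k) eq ⟨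
      (phase w x + 1) % suc k                 ≡⟨ %-absorbˡ (phase w x) 1 (suc k) ⟨
      (phase w x % suc k + 1) % suc k         ≡⟨ cong (λ t → (t + 1) % suc k) p≡0 ⟩
      1 % suc k                               ≤⟨ m%n≤m 1 (suc k) ⟩
      1                                       ∎))
      where open ≤-Reasoning
    shift (suc zero) p≡1 _ = inj₁ λ y same eq → on-level y same (begin-strict
      phase w y % suc k                       ≡⟨ cong (_% suc k) (trans eq (+-comm k _)) ⟩
      (phase w x + k) % suc k                 ≡⟨ %-absorbˡ (phase w x) k (suc k) ⟨
      (phase w x % suc k + k) % suc k         ≡⟨ cong (λ t → (t + k) % suc k) p≡1 ⟩
      suc k % suc k                           ≡⟨ n%n≡0 (suc k) ⟩
      0                                       <⟨ s≤s z≤n ⟩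
      2                                       ∎)
      where open ≤-Reasoning
    shift (suc (suc p)) _ (s≤s (s≤s ()))

-- The size of the seed.

size-suc : ∀ {n d} (ω : Config n (suc d)) → size ω ≡ ∑ λ a → size (ω ∘ (a ∷_))
size-suc ω = vertexSum-suc (b2n ∘ ω)

size-empty : ∀ {n d} {ω : Config n d} → (∀ x → ¬ T (ω x)) → size ω ≡ 0
size-empty {n} {d} empty = n≤0⇒n≡0 (≤-trans
  (vertexSum-mono {g = λ _ → 0} λ x → b2n-mono {c = false} (λ Tω → contradiction Tω (empty x)))
  (≤-reflexive (zeros (allVertices n d))))
  where
  zeros : ∀ {A : Set} (xs : List A) → sum (map (λ _ → 0) xs) ≡ 0
  zeros []       = refl
  zeros (x ∷ xs) = zeros xs

size-∨ : ∀ {n d} (ω ω′ : Config n d) → size (λ x → ω x ∨ ω′ x) ≤ size ω + size ω′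
size-∨ {n} {d} ω ω′ = ≤-trans (vertexSum-mono λ x → b2n-∨ (ω x) (ω′ x))
  (≤-reflexive (sum-map-+ (b2n ∘ ω) (b2n ∘ ω′) (allVertices n d)))
  where
  b2n-∨ : ∀ b c → b2n (b ∨ c) ≤ b2n b + b2n c
  b2n-∨ true  c = s≤s z≤n
  b2n-∨ false c = ≤-refl

*∑-≤ : ∀ {n} {f : Fin n → ℕ} r {b} → (∀ i → r * f i ≤ b) → r * ∑ f ≤ n * b
*∑-≤ {zero}      r f≤b = ≤-reflexive (*-zeroʳ r)
*∑-≤ {suc n} {f} r {b} f≤b = begin
  r * ∑ f                              ≡⟨ cong (r *_) (∑-suc f) ⟩
  r * (f zero + ∑ (f ∘ suc))           ≡⟨ *-distribˡ-+ r (f zero) _ ⟩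
  r * f zero + r * ∑ (f ∘ suc)         ≤⟨ +-mono-≤ (f≤b zero) (*∑-≤ r (f≤b ∘ suc)) ⟩
  b + n * b                            ∎
  where open ≤-Reasoning

-- Split on the first coordinate. The values 0 and 1 leave `s` unchanged, and the fewer than n
-- values from 2 on lower it by one. Each of the three contributions is at most the bound for
-- dimension d, whence the factor 3 per dimension.
size-thin : ∀ {m} d s → size {2 + m} {d} (λ x → bigs x <ᵇ suc s) ≤ 3 ^ d * (2 + m) ^ s
size-thin {m} zero s = ≤-trans (m^n>0 (2 + m) s) (≤-reflexive (sym (*-identityˡ _)))
size-thin {m} (suc d) s = begin
  size {n} {suc d} (λ x → bigs x <ᵇ suc s)  ≡⟨ size-suc {n} {d} (λ x → bigs x <ᵇ suc s) ⟩
  ∑ F                                    ≡⟨ trans (∑-suc F) (cong (F zero +_) (∑-suc λ i → F (suc i))) ⟩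
  thin + (thin + ∑ (λ i → F (suc (suc i))))      ≤⟨ +-mono-≤ (size-thin d s) (+-mono-≤ (size-thin d s) (tail s)) ⟩
  b + (b + b)                            ≡⟨ arrange (3 ^ d) (n ^ s) ⟩
  3 * 3 ^ d * n ^ s                      ∎
  where
  open ≤-Reasoning
  n = 2 + m
  b = 3 ^ d * n ^ s
  thin = size {n} {d} (λ x → bigs x <ᵇ suc s)
  F : Fin n → ℕ
  F a = size {n} {d} λ xs → b2n (1 <ᵇ toℕ a) + bigs xs <ᵇ suc s
  arrange : ∀ t p → t * p + (t * p + t * p) ≡ 3 * t * p
  arrange = solve-∀
  swap : ∀ n t p → n * (t * p) ≡ t * (n * p)
  swap = solve-∀
  tail : ∀ s → ∑ {m} (λ _ → size {n} {d} λ xs → bigs xs <ᵇ s) ≤ 3 ^ d * n ^ s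
  -- With s = 0 no coordinate may be 2 or more, so these layers are empty.
  tail zero    = ≤-trans (∑-≤ {m} λ _ → ≤-reflexive (size-empty {n} {d} λ _ ())) (≤-trans (≤-reflexive (*-zeroʳ m)) z≤n)
  tail (suc s) = begin
    ∑ {m} (λ _ → size {n} {d} λ xs → bigs xs <ᵇ suc s)  ≤⟨ ∑-≤ {m} (λ _ → size-thin d s) ⟩
    m * (3 ^ d * n ^ s)                                 ≤⟨ *-monoˡ-≤ _ (m≤n+m m 2) ⟩
    n * (3 ^ d * n ^ s)                                 ≡⟨ swap n (3 ^ d) (n ^ s) ⟩
    3 ^ d * (n * n ^ s)                                 ∎

phase-origin : ∀ {n d} w (x : Vertex n d) → supp x ≡ 0 → phase w x ≡ 0
phase-origin w []          _ = refl
phase-origin w (zero ∷ xs) eq rewrite *-zeroʳ (w (suc (supp xs))) = phase-origin w xs eq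

-- Only the origin has empty support. The constant `p` carries a condition on coordinates that are
-- already fixed.
size-origin : ∀ {n} d p → size {suc n} {d} (λ x → (supp x ≡ᵇ 0) ∧ p) ≤ b2n p
size-origin     zero    p = ≤-reflexive (+-identityʳ (b2n p))
size-origin {n} (suc d) p = begin
  size {suc n} {suc d} (λ x → (supp x ≡ᵇ 0) ∧ p)
    ≡⟨ size-suc {suc n} {d} (λ x → (supp x ≡ᵇ 0) ∧ p) ⟩
  ∑ F
    ≡⟨ ∑-suc F ⟩
  F zero + ∑ (F ∘ suc)
    ≤⟨ +-mono-≤ (size-origin d p) (≤-trans (∑-≤ {n} λ _ → ≤-reflexive (size-empty {suc n} {d} λ _ ())) (≤-reflexive (*-zeroʳ n))) ⟩
  b2n p + 0
    ≡⟨ +-identityʳ _ ⟩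
  b2n p ∎
  where
  open ≤-Reasoning
  F : Fin (suc n) → ℕ
  F a = size {suc n} {d} λ xs → (supp (a ∷ xs) ≡ᵇ 0) ∧ p

-- If y mod r < σ then y mod r + (r − σ) = (y − σ) mod r; otherwise y mod r − σ = (y − σ) mod r.
-- Summing along y = e + σ, e + 2σ, … telescopes.
progression-hits : ∀ r .{{_ : NonZero r}} σ n e →
  r * ∑ {n} (λ a → b2n ((e + σ + σ * toℕ a) % r <ᵇ σ)) ≤ σ * n + e % r
progression-hits r σ zero e = ≤-trans (≤-reflexive (*-zeroʳ r)) z≤n
progression-hits r σ (suc n) e = begin
  r * ∑ F
    ≡⟨ cong (r *_) (∑-suc F) ⟩
  r * (F zero + ∑ (F ∘ suc))
    ≡⟨ *-distribˡ-+ r (F zero) _ ⟩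
  r * F zero + r * ∑ (F ∘ suc)
    ≤⟨ +-mono-≤ (≤-reflexive (cong (λ t → r * b2n (t % r <ᵇ σ)) (trans (cong (e + σ +_) (*-zeroʳ σ)) (+-identityʳ _))))
                (*-monoʳ-≤ r (∑-mono {n} λ a → ≤-reflexive (cong (λ t → b2n (t % r <ᵇ σ)) (shift e σ (toℕ a))))) ⟩
  r * hit + r * ∑ {n} (λ a → b2n ((e + σ + σ + σ * toℕ a) % r <ᵇ σ))
    ≤⟨ +-monoʳ-≤ (r * hit) (progression-hits r σ n (e + σ)) ⟩
  r * hit + (σ * n + (e + σ) % r)
    ≡⟨ x∙yz≈y∙xz (r * hit) (σ * n) _ ⟩
  σ * n + (r * hit + (e + σ) % r)
    ≤⟨ +-monoʳ-≤ (σ * n) first ⟩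
  σ * n + (σ + e % r)
    ≡⟨ arrange σ n (e % r) ⟩
  σ * suc n + e % r ∎
  where
  open ≤-Reasoning
  F : Fin (suc n) → ℕ
  F a = b2n ((e + σ + σ * toℕ a) % r <ᵇ σ)
  hit = b2n ((e + σ) % r <ᵇ σ)
  shift : ∀ e s a → e + s + s * suc a ≡ e + s + s + s * a
  shift = solve-∀
  arrange : ∀ s n m → s * n + (s + m) ≡ s * suc n + m
  arrange = solve-∀
  first : r * hit + (e + σ) % r ≤ σ + e % r
  first with e % r + σ <? r
  ... | yes below = ≤-reflexive (cong₂ _+_ no-hit (trans value (+-comm (e % r) σ)))
    where
    value : (e + σ) % r ≡ e % r + σ
    value = trans (sym (%-absorbˡ e σ r)) (m<n⇒m%n≡m below)
    no-hit : r * hit ≡ 0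
    no-hit with (e + σ) % r <ᵇ σ in eq
    ... | false = *-zeroʳ r
    ... | true  = contradiction (<ᵇ⇒< _ σ (Equivalence.from T-≡ eq))
                    (≤⇒≯ (≤-trans (m≤n+m σ (e % r)) (≤-reflexive (sym value))))
  ... | no above = begin
    r * hit + (e + σ) % r       ≤⟨ +-mono-≤ (≤-trans (*-monoʳ-≤ r (b2n≤1 ((e + σ) % r <ᵇ σ))) (≤-reflexive (*-identityʳ r))) value ⟩
    r + (e % r + σ ∸ r)         ≡⟨ m+[n∸m]≡n (≮⇒≥ above) ⟩
    e % r + σ                   ≡⟨ +-comm (e % r) σ ⟩
    σ + e % r                   ∎
    where
    value : (e + σ) % r ≤ e % r + σ ∸ r
    value = begin
      (e + σ) % r               ≡⟨ %-absorbˡ e σ r ⟨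
      (e % r + σ) % r           ≡⟨ m≤n⇒[n∸m]%m≡n%m (≮⇒≥ above) ⟨
      (e % r + σ ∸ r) % r       ≤⟨ m%n≤m _ r ⟩
      e % r + σ ∸ r             ∎

module _ (k σ : ℕ) (σ≤r : σ ≤ suc k) where

  private
    r = suc k
    w = weight k σ

  -- If σ ≤ k, rank 1 has weight σ and the values form a progression of step σ, with an end error of
  -- at most r. Otherwise σ = r and the trivial count of n suffices.
  weight₁-hits : ∀ n c → r * ∑ {n} (λ a → b2n ((c + w 1 * toℕ a) % r <ᵇ σ)) ≤ σ * n + r
  weight₁-hits n c with σ * 1 ≤? k
  ... | yes small rewrite weight-small k σ 1 small | *-identityʳ σ = begin
    r * ∑ {n} (λ a → b2n ((c + σ * toℕ a) % r <ᵇ σ))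
      ≤⟨ *-monoʳ-≤ r (∑-mono {n} λ a → ≤-reflexive (cong (λ t → b2n (t <ᵇ σ)) (shift (toℕ a)))) ⟩
    -- Adding r, written as (r - σ) + σ, brings the progression to the starting form e + σ.
    r * ∑ {n} (λ a → b2n ((c + (r ∸ σ) + σ + σ * toℕ a) % r <ᵇ σ))
      ≤⟨ progression-hits r σ n (c + (r ∸ σ)) ⟩
    σ * n + (c + (r ∸ σ)) % r
      ≤⟨ +-monoʳ-≤ (σ * n) (m%n≤n (c + (r ∸ σ)) r) ⟩
    σ * n + r ∎
    where
    open ≤-Reasoning
    shift : ∀ a → (c + σ * a) % r ≡ (c + (r ∸ σ) + σ + σ * a) % r
    shift a = begin-equality
      (c + σ * a) % r                     ≡⟨ [m+n]%n≡m%n (c + σ * a) r ⟨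
      (c + σ * a + r) % r                 ≡⟨ cong (_% r) (xy∙z≈xz∙y c (σ * a) r) ⟩
      (c + r + σ * a) % r                 ≡⟨ cong (λ t → (c + t + σ * a) % r) (m∸n+n≡m σ≤r) ⟨
      (c + (r ∸ σ + σ) + σ * a) % r       ≡⟨ cong (λ t → (t + σ * a) % r) (+-assoc c (r ∸ σ) σ) ⟨
      (c + (r ∸ σ) + σ + σ * a) % r       ∎

  ... | no large = begin
    r * ∑ {n} (λ a → b2n ((c + w 1 * toℕ a) % r <ᵇ σ))  ≤⟨ *-monoʳ-≤ r (∑-≤ {n} λ a → b2n≤1 _) ⟩
    r * (n * 1)                                         ≤⟨ *-mono-≤ (≤-trans (≰⇒> large) (≤-reflexive (*-identityʳ σ))) (≤-reflexive (*-identityʳ n)) ⟩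
    σ * n                                               ≤⟨ m≤m+n _ r ⟩
    σ * n + r                                           ∎
    where open ≤-Reasoning

  -- Pascal's rule on the first coordinate: zero leaves C(d, κ + 1), nonzero leaves C(d, κ). The
  -- offset `c` collects the phase of the coordinates already fixed. The fraction σ / r comes from
  -- the coordinate of rank 1 alone; the other κ are counted trivially by powers of n.
  size-phase : ∀ {n} d κ c →
    r * size {suc n} {d} (λ x → (supp x ≡ᵇ suc κ) ∧ ((c + phase w x) % r <ᵇ σ))
      ≤ (d C suc κ) * ((σ * suc n + r) * suc n ^ κ)
  size-phase zero κ c = ≤-trans (≤-reflexive (*-zeroʳ r)) z≤n
  size-phase {n} (suc d) κ c = begin
    r * size {N} {suc d} (λ x → (supp x ≡ᵇ suc κ) ∧ ((c + phase w x) % r <ᵇ σ))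
      ≡⟨ cong (r *_) (trans (size-suc {N} {d} (λ x → (supp x ≡ᵇ suc κ) ∧ ((c + phase w x) % r <ᵇ σ))) (∑-suc layer)) ⟩
    r * (layer zero + ∑ (layer ∘ suc))
      ≡⟨ *-distribˡ-+ r (layer zero) _ ⟩
    r * layer zero + r * ∑ (layer ∘ suc)
      ≤⟨ +-mono-≤ (≤-trans (*-monoʳ-≤ r bottom) (size-phase d κ c)) (upper κ) ⟩
    (d C suc κ) * b κ + (d C κ) * b κ
      ≡⟨ *-distribʳ-+ (b κ) (d C suc κ) (d C κ) ⟨
    (d C suc κ + d C κ) * b κ
      ≡⟨ cong (_* b κ) (trans (+-comm (d C suc κ) _) (nCk+nC[k+1]≡[n+1]C[k+1] d κ)) ⟩
    (suc d C suc κ) * b κ ∎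
    where
    open ≤-Reasoning
    N = suc n
    b : ℕ → ℕ
    b κ = (σ * N + r) * N ^ κ
    layer : Fin N → ℕ
    layer a = size {N} {d} λ xs → (supp (a ∷ xs) ≡ᵇ suc κ) ∧ ((c + phase w (a ∷ xs)) % r <ᵇ σ)

    bottom : layer zero ≤ size {N} {d} (λ xs → (supp xs ≡ᵇ suc κ) ∧ ((c + phase w xs) % r <ᵇ σ))
    bottom = size-mono {N} {d} λ xs →
      subst (λ t → T ((supp xs ≡ᵇ suc κ) ∧ ((c + (t + phase w xs)) % r <ᵇ σ))) (*-zeroʳ (w (suc (supp xs))))

    upper : ∀ κ → r * ∑ {n} (λ i → size {N} {d} λ xs →
        (supp xs ≡ᵇ κ) ∧ ((c + phase w (suc i ∷ xs)) % r <ᵇ σ)) ≤ (d C κ) * b κ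
    -- All later coordinates vanish, so the current one has rank 1.
    upper zero = begin
      r * ∑ {n} (λ i → size {N} {d} λ xs → (supp xs ≡ᵇ 0) ∧ ((c + phase w (suc i ∷ xs)) % r <ᵇ σ))
        ≤⟨ *-monoʳ-≤ r (∑-mono {n} λ i → ≤-trans (size-mono {N} {d} (axis i)) (size-origin d (hit (suc i)))) ⟩
      r * ∑ {n} (b2n ∘ hit ∘ suc)
        ≤⟨ *-monoʳ-≤ r (≤-trans (m≤n+m _ (b2n (hit zero))) (≤-reflexive (sym (∑-suc (b2n ∘ hit))))) ⟩
      r * ∑ {N} (b2n ∘ hit)
        ≤⟨ weight₁-hits N c ⟩
      σ * N + r
        ≡⟨ *-identityʳ _ ⟨
      b 0
        ≡⟨ *-identityˡ (b 0) ⟨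
      1 * b 0
        ≡⟨ cong (_* b 0) (trans (nCk≡nC[n∸k] {0} {d} z≤n) (nCn≡1 d)) ⟨
      (d C 0) * b 0 ∎
      where
      hit : Fin N → Bool
      hit a = (c + w 1 * toℕ a) % r <ᵇ σ
      axis : ∀ i (xs : Vertex N d) →
        T ((supp xs ≡ᵇ 0) ∧ ((c + phase w (suc i ∷ xs)) % r <ᵇ σ)) → T ((supp xs ≡ᵇ 0) ∧ hit (suc i))
      axis i xs active with supp xs in eq
      ... | zero rewrite phase-origin w xs eq | +-identityʳ (w 1 * suc (toℕ i)) = active
    -- The head has rank κ + 2; its contribution to the phase moves into the offset of each fibre.
    upper (suc κ) = begin
      r * ∑ {n} (λ i → size {N} {d} λ xs → (supp xs ≡ᵇ suc κ) ∧ ((c + phase w (suc i ∷ xs)) % r <ᵇ σ))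
        ≤⟨ *∑-≤ {n} r (λ i → ≤-trans (*-monoʳ-≤ r (size-mono {N} {d} (fibre i)))
             (size-phase d κ (c + w (2 + κ) * suc (toℕ i)))) ⟩
      n * ((d C suc κ) * b κ)
        ≤⟨ *-monoˡ-≤ _ (n≤1+n n) ⟩
      N * ((d C suc κ) * b κ)
        ≡⟨ arrange N (d C suc κ) (σ * N + r) (N ^ κ) ⟩
      (d C suc κ) * b (suc κ) ∎
      where
      arrange : ∀ n c l p → n * (c * (l * p)) ≡ c * (l * (n * p))
      arrange = solve-∀
      fibre : ∀ i (xs : Vertex N d) →
        T ((supp xs ≡ᵇ suc κ) ∧ ((c + phase w (suc i ∷ xs)) % r <ᵇ σ)) →
        T ((supp xs ≡ᵇ suc κ) ∧ ((c + w (2 + κ) * suc (toℕ i) + phase w xs) % r <ᵇ σ))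
      fibre i xs active with supp xs ≡ᵇ suc κ in eq
      ... | true = subst (λ t → T (t % r <ᵇ σ))
        (trans (cong (λ s → c + (w (suc s) * suc (toℕ i) + phase w xs)) (≡ᵇ⇒≡ _ _ (Equivalence.from T-≡ eq)))
               (sym (+-assoc c _ _))) active

nC0≡1 : ∀ n → n C 0 ≡ 1
nC0≡1 n = trans (nCk≡nC[n∸k] {0} {n} z≤n) (nCn≡1 n)

module _ (m d : ℕ) where

  private n = 3 + m

  -- The factor n r clears all denominators. The thin vertices and the end errors of the
  -- progressions are both of order n^κ, which gives the constant 3^d + C(d, k).
  size-seed : ∀ κ σ → σ ≤ 2 + κ →
    n * (2 + κ) * size {n} {d} (seed (suc κ) σ)
      ≤ σ * (d C suc κ) * n ^ (2 + κ) + (2 + κ) * (3 ^ d + d C suc κ) * n ^ suc κ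
  size-seed κ σ σ≤r = begin
    n * r * size {n} {d} (seed k σ)
      ≤⟨ *-monoʳ-≤ (n * r) (≤-trans (size-mono {n} {d} split) (size-∨ thin cells)) ⟩
    n * r * (size thin + size cells)
      ≡⟨ expand n r (size thin) (size cells) ⟩
    n * r * size thin + n * (r * size cells)
      ≤⟨ +-mono-≤ (*-monoʳ-≤ (n * r) (size-thin d κ)) (*-monoʳ-≤ n (size-phase k σ σ≤r d κ 0)) ⟩
    n * r * (3 ^ d * n ^ κ) + n * ((d C k) * ((σ * n + r) * n ^ κ))
      ≡⟨ arrange n r (3 ^ d) (n ^ κ) (d C k) σ ⟩
    σ * (d C k) * (n * (n * n ^ κ)) + r * (3 ^ d + d C k) * (n * n ^ κ) ∎
    where
    open ≤-Reasoning
    k = suc κ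
    r = 2 + κ
    thin cells : Config n d
    thin x  = bigs x <ᵇ k
    cells x = (supp x ≡ᵇ k) ∧ (phase (weight k σ) x % r <ᵇ σ)
    split : seed k σ ⊑ λ x → thin x ∨ cells x
    split x active with bigs x <? k
    ... | yes few = Equivalence.from T-∨ (inj₁ (<⇒<ᵇ few))
    ... | no many with seed⇒phase k σ x active many
    ... | supp≤k , small = Equivalence.from (T-∨ {x = thin x}) (inj₂ (Equivalence.from T-∧
            (≡⇒≡ᵇ (supp x) k (≤-antisym supp≤k (≤-trans (≮⇒≥ many) (bigs≤supp x))) , <⇒<ᵇ small)))
    expand : ∀ n r s t → n * r * (s + t) ≡ n * r * s + n * (r * t)
    expand = solve-∀
    arrange : ∀ n r t p c σ →
      n * r * (t * p) + n * (c * ((σ * n + r) * p)) ≡ σ * c * (n * (n * p)) + r * (t + c) * (n * p)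
    arrange = solve-∀

  size-seed₁ : size {n} {d} (seed 0 1) ≤ 1
  size-seed₁ = ≤-trans (size-mono {n} {d} only-origin) (size-origin d true)
    where
    only-origin : seed 0 1 ⊑ λ x → (supp x ≡ᵇ 0) ∧ true
    only-origin x active = Equivalence.from T-∧
      (≡⇒≡ᵇ (supp x) 0 (n≤0⇒n≡0 (proj₁ (seed⇒phase 0 1 x active λ()))) , _)

-- Reversible seed for r = 1: the origin and its neighbour on the first axis.

edge : ∀ {n d} → Config n (suc d)
edge (a ∷ xs) = (supp xs ≡ᵇ 0) ∧ (toℕ a <ᵇ 2)

module _ {m d : ℕ} where

  private n = 3 + m

  edge-stable : (x : Vertex n (suc d)) → T (edge x) → 1 ≤ activeNbrs edge x
  edge-stable (a ∷ xs) active with at-axis , a<2 ← Equivalence.to (T-∧ {x = supp xs ≡ᵇ 0}) active =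
    ≤-trans (partner a a<2) (sideNbrs≤activeNbrs edge (a ∷ xs))
    where
    partner : ∀ a → T (toℕ a <ᵇ 2) → 1 ≤ sideNbrs edge (a ∷ xs)
    partner zero       _ = one≤ 0 (Equivalence.from T-∧ (at-axis , _)) z≤n
    partner (suc zero) _ = one≤ _ (Equivalence.from T-∧ (at-axis , _)) z≤n

  edge-percolating : Percolating {n} {suc d} 1 edge
  edge-percolating x@(a ∷ xs) with supp x in eq
  ... | suc s = inj₂ (begin
    1                          ≤⟨ s≤s z≤n ⟩
    suc s                      ≡⟨ eq ⟨
    supp x                     ≤⟨ supp≤sideNbrs x (λ y y< → Equivalence.from (T-∨ {x = edge y}) (inj₂ (<⇒<ᵇ y<))) ⟩
    sideNbrs (edge ∪↓ x) x     ≤⟨ sideNbrs≤activeNbrs (edge ∪↓ x) x ⟩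
    activeNbrs (edge ∪↓ x) x   ∎)
    where open ≤-Reasoning
  edge-percolating (zero ∷ xs) | zero = inj₁ (Equivalence.from T-∧ (≡⇒≡ᵇ (supp xs) 0 eq , _))

  size-edge : size {n} {suc d} edge ≤ 2
  size-edge = begin
    size {n} {suc d} edge
      ≡⟨ size-suc {n} {d} edge ⟩
    ∑ {n} (λ a → size {n} {d} λ xs → (supp xs ≡ᵇ 0) ∧ (toℕ a <ᵇ 2))
      ≤⟨ ∑-mono {n} (λ a → size-origin d (toℕ a <ᵇ 2)) ⟩
    ∑ near
      ≡⟨ trans (∑-suc near) (cong (1 +_) (∑-suc λ i → near (suc i))) ⟩
    2 + ∑ {1 + m} (λ _ → 0)
      ≤⟨ +-monoʳ-≤ 2 (∑-≤ {1 + m} λ _ → ≤-refl) ⟩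
    2 + (1 + m) * 0
      ≡⟨ cong (2 +_) (*-zeroʳ (1 + m)) ⟩
    2 ∎
    where
    open ≤-Reasoning
    near : Fin n → ℕ
    near a = b2n (toℕ a <ᵇ 2)

-- Both bounds, with explicit constants.

theorem4 : (d r : ℕ) → 1 ≤ d → 1 ≤ r → r ≤ d →
    Σ ℕ λ K → 0 < K × Σ ℕ λ n₀ → (n : ℕ) → n₀ ≤ n →
    (Σ (Config n d) λ ω → IsMonotoneDynamo (revStep r) ω ×
    n * r * size ω ≤ 2 * (d C (r ∸ 1)) * n ^ r + r * K * n ^ (r ∸ 1))
    × (Σ (Config n d) λ ω → IsDynamo (bpStep r) ω ×
    n * r * size ω ≤ (d C (r ∸ 1)) * n ^ r + r * K * n ^ (r ∸ 1))
-- As C(d, 0) = 1, the seeds of size 2 and 1 fit under the leading terms; K = 1 is chosen to be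
-- positive.
theorem4 d@(suc d′) 1 _ _ _ = 1 , s≤s z≤n , 3 , λ
  { n@(suc (suc (suc m))) (s≤s (s≤s (s≤s _))) →
    (edge , revStep-monotoneDynamo 1 edge-stable edge-percolating , point-bound n 2 (size-edge {m} {d′})) ,
    (seed 0 1 , bpStep-dynamo 1 (seed-percolating 0 1 ≤-refl) ,
      subst (λ c → n * 1 * size {n} {d} (seed 0 1) ≤ c * n ^ 1 + 1 * 1 * 1) (*-identityˡ (d C 0)) (point-bound n 1 (size-seed₁ m d))) }
  where
  point-bound : ∀ n s {t} → t ≤ s → n * 1 * t ≤ s * (d C 0) * n ^ 1 + 1 * 1 * 1
  point-bound n s {t} t≤s rewrite nC0≡1 d = begin
    n * 1 * t              ≤⟨ *-monoʳ-≤ (n * 1) t≤s ⟩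
    n * 1 * s              ≡⟨ arrange n s ⟩
    s * 1 * n ^ 1          ≤⟨ m≤m+n _ 1 ⟩
    s * 1 * n ^ 1 + 1      ∎
    where
    open ≤-Reasoning
    arrange : ∀ n s → n * 1 * s ≡ s * 1 * (n * 1)
    arrange = solve-∀
-- K is the constant of `size-seed`, and n₀ = 3 keeps the two neighbours along each coordinate
-- distinct.
theorem4 d r@(suc k@(suc κ)) _ _ r≤d = 3 ^ d + d C k , ≤-trans (m^n>0 3 d) (m≤m+n _ _) , 3 , λ
  { n@(suc (suc (suc m))) (s≤s (s≤s (s≤s _))) →
    (seed k 2 , revStep-monotoneDynamo r (seed-stable k (s≤s z≤n) r≤d) (seed-percolating k 2 (s≤s z≤n)) ,
      size-seed m d κ 2 (s≤s (s≤s z≤n))) ,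
    (seed k 1 , bpStep-dynamo r (seed-percolating k 1 ≤-refl) ,
      subst (λ c → n * r * size {n} {d} (seed k 1) ≤ c * n ^ r + r * (3 ^ d + d C k) * n ^ k) (*-identityˡ (d C k))
        (size-seed m d κ 1 (s≤s z≤n))) }
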